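{- If a finite connected undirected graph $G$ has no stubborn edge, then there is a 2-edge-colouring $c:E(G)\to\{1,2\}$ under which $G$ is properly connected.
   Context: A walk is a sequence of vertices with consecutive vertices adjacent (vertices and edges may repeat); its length is its number of edges; it is closed if it starts and ends at the same vertex. An edge is stubborn if it belongs to every closed walk of odd length in $G$. A walk in an edge-coloured graph is properly coloured if no two consecutive edges of it have the same colour; the coloured graph is properly connected if every two vertices are joined by a properly coloured walk. -}

module Defs where

open import Data.Nat using (ℕ; zero; suc; _+_)
open import Data.Unit using (⊤)
open import Data.Fin using (Fin)
open import Data.Bool using (Bool; true; false; T)
open import Data.Product using (Σ; ∃; _×_; _,_)
open import Data.Sum using (_⊎_)
open import Data.Empty using (⊥)
open import Relation.Binary.PropositionalEquality using (_≡_; _≢_)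
open import Relation.Nullary using (¬_)

record Graph (n : ℕ) : Set where
  field
    adj     : Fin n → Fin n → Bool
    adj-sym : ∀ u v → adj u v ≡ adj v u
    loopless : ∀ v → adj v v ≡ false

Odd : ℕ → Set
Odd m = ∃ λ k → m ≡ suc (k + k)

module _ {n : ℕ} (G : Graph n) where
  open Graph G

  Adj : Fin n → Fin n → Set
  Adj u v = T (adj u v)

  data Walk : Fin n → Fin n → Set where
    [_]  : (v : Fin n) → Walk v v
    _∷⟨_⟩_ : (u : Fin n) {w v : Fin n} → Adj u w → Walk w v → Walk u v

  len : ∀ {u v} → Walk u v → ℕ
  len [ _ ]          = zero
  len (_ ∷⟨ _ ⟩ W)   = suc (len W)

  UsesEdge : Fin n → Fin n → ∀ {u v} → Walk u v → Set
  UsesEdge x y [ _ ] = ⊥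
  UsesEdge x y (_∷⟨_⟩_ u {w} _ W) = ((u ≡ x × w ≡ y) ⊎ (u ≡ y × w ≡ x)) ⊎ UsesEdge x y W

  Stubborn : Fin n → Fin n → Set
  Stubborn x y = Adj x y × (∀ u (W : Walk u u) → Odd (len W) → UsesEdge x y W)

  Connected : Set
  Connected = ∀ u v → Walk u v

  -- 2-edge-colourings: a colour in Fin 2 for each unordered pair
  -- (only its values on edges matter); symmetry makes it a function on E(G).
  record Colouring : Set where
    field
      col     : Fin n → Fin n → Fin 2
      col-sym : ∀ u v → col u v ≡ col v u

  module _ (c : Colouring) where
    open Colouring c

    ProperlyColoured : ∀ {u v} → Walk u v → Set
    ProperlyColoured [ _ ] = ⊤
    ProperlyColoured (u ∷⟨ _ ⟩ [ _ ]) = ⊤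
    ProperlyColoured (_∷⟨_⟩_ u {w} _ (_∷⟨_⟩_ .w {z} a W)) =
      col u w ≢ col w z × ProperlyColoured (w ∷⟨ a ⟩ W)

    ProperlyConnected : Set
    ProperlyConnected = ∀ u v → Σ (Walk u v) ProperlyColoured

{-# OPTIONS --safe #-}
module Submission where

-- Let a state (x , i) mean "at x, about to use colour i".  An edge xy of colour i gives the arcs
-- (x , i) → (y , not i) and (y , i) → (x , not i), so reversing all arcs and flipping all colours is
-- a symmetry.  An uncoloured edge may be used with either colour.  Initially every edge is
-- uncoloured and, G being connected and not bipartite, the state digraph is strongly connected.
-- Edges are coloured one at a time, keeping the states over a vertex set K strongly connected
-- and G[K] without stubborn edges.  If neither colour of an edge e works, the symmetry leaves two
-- possibilities: G[K] − e is bipartite, so e is stubborn, or e is a bridge of G[K] with a bipartite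
-- side, and K shrinks to the other side.  Once K is fully coloured, the remaining vertices are
-- attached one by one: if every vertex x has a colour c(x) such that any x and y are joined by a
-- walk with first edge of colour c(x) and last edge of colour c(y), then a new neighbour of p,
-- joined to it by an edge of the colour other than c(p), can be given that colour as its own.

open import Defs
open import Data.Nat using (ℕ; zero; suc; _+_)
open import Data.Nat.Properties using (+-suc)
open import Data.Fin using (Fin; zero; suc)
import Data.Fin.Properties as Fin
open import Data.Bool using (Bool; true; false; not; if_then_else_; T; T?)
open import Data.Bool.Properties using (not-involutive; not-¬; ¬-not)
import Data.Bool.Properties as Bool
open import Data.Empty using (⊥; ⊥-elim)
open import Data.Unit using (⊤; tt)
open import Data.List using (List; []; _∷_; allFin; cartesianProduct)
open import Data.List.Membership.Propositional using (_∈_)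
open import Data.List.Membership.Propositional.Properties using (∈-allFin; ∈-cartesianProduct⁺)
open import Data.List.Relation.Unary.Any using (here; there)
open import Data.Product using (Σ; ∃; _×_; _,_; proj₁; proj₂)
open import Data.Product.Properties using (≡-dec)
open import Data.Sum using (_⊎_; inj₁; inj₂; [_,_]′)
import Data.Sum as Sum
open import Function using (_∘_; id)
open import Relation.Binary.Construct.Closure.ReflexiveTransitive using (Star; ε; _◅_; _◅◅_; _⋆; gmap)
open import Relation.Binary.Definitions using (Decidable; DecidableEquality)
open import Relation.Binary.PropositionalEquality using (_≡_; _≢_; refl; sym; trans; cong; subst)
open import Relation.Nullary using (¬_; Dec; yes; no; does; contradiction)
open import Relation.Nullary.Decidable using (map′; _×-dec_; _⊎-dec_; _→-dec_; ¬?; dec-true; dec-false)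

-- Decidability of reachability in a finite digraph.

module Reachability {S : Set} (_≟_ : DecidableEquality S) {_⟶_ : S → S → Set} (_⟶?_ : Decidable _⟶_) where

  -- Paths whose interior vertices lie in the given list, as in Warshall's algorithm.
  Via : List S → S → S → Set
  Via []      s t = s ≡ t ⊎ s ⟶ t
  Via (m ∷ L) s t = Via L s t ⊎ (Via L s m × Via L m t)

  via? : ∀ L → Decidable (Via L)
  via? []      s t = (s ≟ t) ⊎-dec (s ⟶? t)
  via? (m ∷ L) s t = via? L s t ⊎-dec (via? L s m ×-dec via? L m t)

  via⇒star : ∀ L {s t} → Via L s t → Star _⟶_ s t
  via⇒star []      (inj₁ refl)    = ε
  via⇒star []      (inj₂ a)       = a ◅ ε
  via⇒star (_ ∷ L) (inj₁ p)       = via⇒star L p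
  via⇒star (_ ∷ L) (inj₂ (p , q)) = via⇒star L p ◅◅ via⇒star L q

  edge⇒via : ∀ L {s t} → s ≡ t ⊎ s ⟶ t → Via L s t
  edge⇒via []      e = e
  edge⇒via (_ ∷ L) e = inj₁ (edge⇒via L e)

  -- When both paths visit the head of the list, the stretch between the first visit and the last is
  -- cut out, so the head is passed only once.
  via-trans : ∀ L {s m t} → m ∈ L → Via L s m → Via L m t → Via L s t
  via-trans (_ ∷ L) (here refl) p q = inj₂ ([ id , proj₁ ]′ p , [ id , proj₂ ]′ q)
  via-trans (_ ∷ L) (there m∈L) (inj₁ p)       (inj₁ q)       = inj₁ (via-trans L m∈L p q)
  via-trans (_ ∷ L) (there m∈L) (inj₁ p)       (inj₂ (q , r)) = inj₂ (via-trans L m∈L p q , r)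
  via-trans (_ ∷ L) (there m∈L) (inj₂ (p , q)) (inj₁ r)       = inj₂ (p , via-trans L m∈L q r)
  via-trans (_ ∷ L) (there m∈L) (inj₂ (p , _)) (inj₂ (_ , r)) = inj₂ (p , r)

  star⇒via : ∀ L → (∀ s → s ∈ L) → ∀ {s t} → Star _⟶_ s t → Via L s t
  star⇒via L all ε       = edge⇒via L (inj₁ refl)
  star⇒via L all (a ◅ p) = via-trans L (all _) (edge⇒via L (inj₂ a)) (star⇒via L all p)

  star? : ∀ L → (∀ s → s ∈ L) → Decidable (Star _⟶_)
  star? L all s t = map′ (via⇒star L) (star⇒via L all) (via? L s t)

-- The state digraph and its reversal symmetry.

module Arcs {n : ℕ} where

  V State : Set
  V = Fin n
  State = V × Bool

  Arrows : Set₁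
  Arrows = V → V → Bool → Set

  data Arc (A : Arrows) : State → State → Set where
    arc : ∀ {x y i} → A x y i → Arc A (x , i) (y , not i)

  Reach : Arrows → State → State → Set
  Reach A = Star (Arc A)

  reach-mono : ∀ {A B : Arrows} → (∀ {x y i} → A x y i → B x y i) → ∀ {s t} → Reach A s t → Reach B s t
  reach-mono f = gmap id λ { (arc a) → arc (f a) }

  states : List State
  states = cartesianProduct (allFin n) (true ∷ false ∷ [])

  ∈-states : ∀ s → s ∈ states
  ∈-states (x , true)  = ∈-cartesianProduct⁺ (∈-allFin x) (here refl)
  ∈-states (x , false) = ∈-cartesianProduct⁺ (∈-allFin x) (there (here refl))

  arc? : ∀ {A : Arrows} → (∀ x y i → Dec (A x y i)) → Decidable (Arc A)
  arc? A? (x , i) (y , j) with j Bool.≟ not i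
  ... | yes refl = map′ arc (λ { (arc a) → a }) (A? x y i)
  ... | no  j≢   = no λ { (arc _) → j≢ refl }

  abstract
    reach? : ∀ {A : Arrows} → (∀ x y i → Dec (A x y i)) → Decidable (Reach A)
    reach? A? = Reachability.star? (≡-dec Fin._≟_ Bool._≟_) (arc? A?) states ∈-states

  module Skew {A : Arrows} (A-sym : ∀ {x y i} → A x y i → A y x i) where

    -- A nonempty path ending in `(y , j)` last used colour `not j`, which is the colour its
    -- reversal has to start with.
    reverse : ∀ {x y i j} → Reach A (x , i) (y , j) → Reach A (y , not j) (x , not i)
    reverse ε = ε
    reverse {i = true}  (arc a ◅ p) = reverse p ◅◅ (arc (A-sym a) ◅ ε)
    reverse {i = false} (arc a ◅ p) = reverse p ◅◅ (arc (A-sym a) ◅ ε)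

    reverseˡ : ∀ {x y i j} → Reach A (x , not i) (y , j) → Reach A (y , not j) (x , i)
    reverseˡ {i = true}  = reverse
    reverseˡ {i = false} = reverse

    reverseˡʳ : ∀ {x y i j} → Reach A (x , not i) (y , not j) → Reach A (y , j) (x , i)
    reverseˡʳ {j = true}  = reverseˡ
    reverseˡʳ {j = false} = reverseˡ

    -- If every state over X communicates with exactly one of the two states of z,
    -- then which one it is two-colours X properly.
    module Bipartition
      (A? : ∀ x y i → Dec (A x y i)) {X : V → Set} {z : V}
      (out : ∀ {x} → X x → ∀ i → ∃ λ j → Reach A (x , i) (z , j))
      (apart : ∀ i → ¬ Reach A (z , i) (z , not i))
      where

      side : V → Bool
      side x = does (reach? A? (x , true) (z , true))

      into : ∀ {x} → X x → ∀ i → ∃ λ j → Reach A (z , j) (x , i)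
      into Xx i with out Xx (not i)
      ... | j , p = not j , reverseˡ p

      unique : ∀ j k → Reach A (z , j) (z , k) → j ≡ k
      unique true  true  _ = refl
      unique true  false p = contradiction p (apart true)
      unique false true  p = contradiction p (apart false)
      unique false false _ = refl

      -- The state of `z` communicating with `(x , i)` turns out to be `(z , shift (side x) i)`.
      shift : Bool → Bool → Bool
      shift k i = if k then i else not i

      shift-not : ∀ k i → shift k (not i) ≡ not (shift k i)
      shift-not true  i = refl
      shift-not false i = refl

      true⇒side : ∀ {x} → X x → Reach A (x , true) (z , side x)
      true⇒side {x} Xx with reach? A? (x , true) (z , true) | out Xx true
      ... | yes p | _         = p
      ... | no ¬p | true  , p = contradiction p ¬p
      ... | no _  | false , p = p

      -- Some state of `z` reaches `(x , true)`, which goes on to `(z , side x)`; `apart` forces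
      -- these two states of `z` to coincide.
      side⇒true : ∀ {x} → X x → Reach A (z , side x) (x , true)
      side⇒true {x} Xx with into Xx true
      ... | j , p = subst (λ k → Reach A (z , k) (x , true)) (unique j (side x) (p ◅◅ true⇒side Xx)) p

      shift-true : ∀ k → shift k true ≡ k
      shift-true true  = refl
      shift-true false = refl

      shift-false : ∀ k → shift k false ≡ not k
      shift-false true  = refl
      shift-false false = refl

      to : ∀ {x} → X x → ∀ i → Reach A (x , i) (z , shift (side x) i)
      to {x} Xx true  rewrite shift-true  (side x) = true⇒side Xx
      to {x} Xx false rewrite shift-false (side x) = reverse (side⇒true Xx)

      from : ∀ {x} → X x → ∀ i → Reach A (z , shift (side x) i) (x , i)
      from {x} Xx true  rewrite shift-true  (side x) = side⇒true Xx
      from {x} Xx false rewrite shift-false (side x) = reverse (true⇒side Xx)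

      -- If the sides agreed, going from `z` to `p`, across the edge, and from `q` back to `z` would
      -- end in the opposite state of `z`.
      side-proper : ∀ {p q i} → X p → X q → A p q i → side p ≢ side q
      side-proper {p} {q} {i} Xp Xq a eq = apart (shift (side p) i)
        (subst (λ k → Reach A (z , shift (side p) i) (z , k)) turn
          (from Xp i ◅◅ (arc a ◅ to Xq (not i))))
        where
        turn : shift (side q) (not i) ≡ not (shift (side p) i)
        turn rewrite sym eq = shift-not (side p) i

open Arcs

-- Partially coloured subgraphs.

SameEdge : ∀ {n} → (u v p q : Fin n) → Set
SameEdge u v p q = (p ≡ u × q ≡ v) ⊎ (p ≡ v × q ≡ u)

sameEdge? : ∀ {n} (u v p q : Fin n) → Dec (SameEdge u v p q)
sameEdge? u v p q = ((p Fin.≟ u) ×-dec (q Fin.≟ v)) ⊎-dec ((p Fin.≟ v) ×-dec (q Fin.≟ u))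

sameEdge-flip : ∀ {n} {u v p q : Fin n} → SameEdge u v p q → SameEdge u v q p
sameEdge-flip (inj₁ (p≡u , q≡v)) = inj₂ (q≡v , p≡u)
sameEdge-flip (inj₂ (p≡v , q≡u)) = inj₁ (q≡u , p≡v)

module _ {n : ℕ} (G : Graph n) where

  open Graph G

  Adj-sym : ∀ {x y} → Adj G x y → Adj G y x
  Adj-sym {x} {y} = subst T (adj-sym x y)

  -- Such a `φ` two-colours G[K] minus the edge xy, so its existence makes every odd closed walk of
  -- G[K] use xy.
  ProperOff : (Fin n → Set) → Fin n → Fin n → (Fin n → Bool) → Set
  ProperOff K x y φ = ∀ {p q} → Adj G p q → K p → K q → ¬ SameEdge x y p q → φ p ≢ φ q

  -- An edge xy with A x y true and A x y false is still uncoloured.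
  record Mixed : Set₁ where
    field
      K        : Fin n → Set
      K?       : ∀ x → Dec (K x)
      A        : Fin n → Fin n → Bool → Set
      A?       : ∀ x y i → Dec (A x y i)
      A-sym    : ∀ {x y i} → A x y i → A y x i
      A⇒Adj    : ∀ {x y i} → A x y i → Adj G x y
      A⇒K      : ∀ {x y i} → A x y i → K x
      coloured : ∀ {x y} → Adj G x y → K x → K y → ∃ (A x y)
      root     : ∃ K
      strong   : ∀ {x y} → K x → K y → ∀ i j → Reach A (x , i) (y , j)
      odd      : ∀ {x y} → Adj G x y → K x → K y → ∀ φ → ¬ ProperOff K x y φ

  open Mixed

  _⊑_ : Mixed → Mixed → Set
  M′ ⊑ M = ∀ {x y i} → A M′ x y i → A M x y i

  -- Holds also when an end lies outside `K`, so an edge lost by shrinking `K` counts as settled.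
  Single : Mixed → Fin n → Fin n → Set
  Single M x y = ¬ (A M x y true × A M x y false)

  Refinement : Mixed → Fin n → Fin n → Set₁
  Refinement M u v = Σ Mixed λ M′ → M′ ⊑ M × Single M′ u v

  -- Settling one uncoloured edge.

  module Refine (M : Mixed) (u v : Fin n) (free : ∀ i → A M u v i) where

    private
      Ku : K M u
      Ku = A⇒K M (free true)
      Kv : K M v
      Kv = A⇒K M (A-sym M (free true))

    N : Fin n → Fin n → Bool → Set
    N x y i = A M x y i × ¬ SameEdge u v x y

    N-sym : ∀ {x y i} → N x y i → N y x i
    N-sym (a , e) = A-sym M a , e ∘ sameEdge-flip

    N? : ∀ x y i → Dec (N x y i)
    N? x y i = A? M x y i ×-dec ¬? (sameEdge? u v x y)

    infix 4 _⇒_ _⇒?_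
    _⇒_ : State → State → Set
    _⇒_ = Reach N

    _⇒?_ : Decidable _⇒_
    _⇒?_ = reach? N?

    open Skew {A = N} N-sym

    module Colour (c : Bool) where

      A′ : Fin n → Fin n → Bool → Set
      A′ x y i = A M x y i × (SameEdge u v x y → i ≡ c)

      A′-sym : ∀ {x y i} → A′ x y i → A′ y x i
      A′-sym (a , e) = A-sym M a , e ∘ sameEdge-flip

      N⇒A′ : ∀ {s t} → s ⇒ t → Reach A′ s t
      N⇒A′ = reach-mono λ (a , e) → a , λ e′ → contradiction e′ e

      vu : Reach A′ (v , c) (u , not c)
      vu = arc (A-sym M (free c) , λ _ → refl) ◅ ε

      module _ (back : Reach A′ (v , not c) (u , c)) where

        back′ : Reach A′ (u , not c) (v , c)
        back′ = Skew.reverseˡ A′-sym back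

        -- Fixing colour `c` deletes only the arcs from `(v , not c)` to `(u , c)` and from
        -- `(u , not c)` to `(v , c)`. The path `back` replaces the first and its reversal the
        -- second, so strong connectivity survives.
        simulate : ∀ {s t} → Arc (A M) s t → Reach A′ s t
        simulate (arc {x} {y} {i} a) with sameEdge? u v x y | i Bool.≟ c
        ... | no  e                    | _        = arc (a , λ e′ → contradiction e′ e) ◅ ε
        ... | yes _                    | yes i≡c  = arc (a , λ _ → i≡c) ◅ ε
        ... | yes (inj₁ (refl , refl)) | no  i≢c rewrite ¬-not i≢c | not-involutive c = back′
        ... | yes (inj₂ (refl , refl)) | no  i≢c rewrite ¬-not i≢c | not-involutive c = back

        refinement : Refinement M u v
        refinement = M′ , proj₁ , λ ((_ , t) , (_ , f)) →
          contradiction (trans (t (inj₁ (refl , refl))) (sym (f (inj₁ (refl , refl))))) λ ()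
          where
          coloured′ : ∀ {x y} → Adj G x y → K M x → K M y → ∃ (A′ x y)
          coloured′ {x} {y} xy Kx Ky with sameEdge? u v x y
          ... | yes (inj₁ (refl , refl)) = c , free c , λ _ → refl
          ... | yes (inj₂ (refl , refl)) = c , A-sym M (free c) , λ _ → refl
          ... | no  e with coloured M xy Kx Ky
          ...   | i , a = i , a , λ e′ → contradiction e′ e

          M′ : Mixed
          M′ = record
            { K        = K M
            ; K?       = K? M
            ; A        = A′
            ; A?       = λ x y i → A? M x y i ×-dec (sameEdge? u v x y →-dec (i Bool.≟ c))
            ; A-sym    = A′-sym
            ; A⇒Adj    = A⇒Adj M ∘ proj₁
            ; A⇒K      = A⇒K M ∘ proj₁
            ; coloured = coloured′
            ; root     = root M
            ; strong   = λ Kx Ky i j → (simulate ⋆) (strong M Kx Ky i j)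
            ; odd      = odd M
            }

    colour-direct : ∀ c → (v , not c) ⇒ (u , c) → Refinement M u v
    colour-direct c p = Colour.refinement c (Colour.N⇒A′ c p)

    -- The replacement path turns at `v`, crosses the edge in its new colour `c`, and turns again at
    -- `u`.
    colour-detour : ∀ c → (v , not c) ⇒ (v , c) → (u , not c) ⇒ (u , c) → Refinement M u v
    colour-detour c p q = refinement (N⇒A′ p ◅◅ (vu ◅◅ N⇒A′ q))
      where open Colour c

    Hit : State → Set
    Hit s = ∃ λ j → s ⇒ (u , j) ⊎ s ⇒ (v , j)

    -- The path is cut at its first use of the edge uv: it stands at `u` or `v` there, and has
    -- avoided the edge so far.
    hit-back : ∀ {s t} → Reach (A M) s t → Hit t → Hit s
    hit-back ε h = h
    hit-back (arc {x} {y} {i} a ◅ p) h with sameEdge? u v x y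
    ... | yes (inj₁ (refl , _)) = i , inj₁ ε
    ... | yes (inj₂ (refl , _)) = i , inj₂ ε
    ... | no e with hit-back p h
    ...   | j , h′ = j , Sum.map (arc (a , e) ◅_) (arc (a , e) ◅_) h′

    hit : ∀ {x} → K M x → ∀ i → Hit (x , i)
    hit Kx i = hit-back (strong M Kx Ku i true) (true , inj₁ ε)

    Crossing : Bool → Set
    Crossing c = (u , c) ⇒ (u , not c) ⊎ (v , not c) ⇒ (v , c) ⊎ (u , c) ⇒ (v , c)

    arrived : ∀ c → (u , c) ⇒ (u , not c) ⊎ (v , not c) ⇒ (u , not c) → Crossing c
    arrived c (inj₁ p) = inj₁ p
    arrived c (inj₂ p) = inj₂ (inj₂ (reverseˡʳ p))

    -- Invariant: the current state is reached, avoiding uv, from `(u , c)` or `(v , not c)`. Two of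
    -- the four arcs over uv lead from one of these sources to the other and restart the invariant;
    -- the other two start at `(u , not c)` or `(v , c)`, where the invariant already gives a
    -- crossing.
    crossing-along : ∀ c {s t} → Reach (A M) s t → t ≡ (u , not c) →
                     (u , c) ⇒ s ⊎ (v , not c) ⇒ s → Crossing c
    crossing-along c ε refl h = arrived c h
    crossing-along c (arc {x} {y} {i} a ◅ r) t≡ h with sameEdge? u v x y
    ... | no e = crossing-along c r t≡ (Sum.map (_◅◅ (arc (a , e) ◅ ε)) (_◅◅ (arc (a , e) ◅ ε)) h)
    crossing-along true  (arc {i = true}  a ◅ r) t≡ h | yes (inj₁ (refl , refl)) = crossing-along true r t≡ (inj₂ ε)
    crossing-along false (arc {i = false} a ◅ r) t≡ h | yes (inj₁ (refl , refl)) = crossing-along false r t≡ (inj₂ ε)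
    crossing-along true  (arc {i = false} a ◅ r) t≡ h | yes (inj₁ (refl , refl)) = arrived true h
    crossing-along false (arc {i = true}  a ◅ r) t≡ h | yes (inj₁ (refl , refl)) = arrived false h
    crossing-along true  (arc {i = false} a ◅ r) t≡ h | yes (inj₂ (refl , refl)) = crossing-along true r t≡ (inj₁ ε)
    crossing-along false (arc {i = true}  a ◅ r) t≡ h | yes (inj₂ (refl , refl)) = crossing-along false r t≡ (inj₁ ε)
    crossing-along true  (arc {i = true}  a ◅ r) t≡ h | yes (inj₂ (refl , refl)) = [ inj₂ ∘ inj₂ , inj₂ ∘ inj₁ ]′ h
    crossing-along false (arc {i = false} a ◅ r) t≡ h | yes (inj₂ (refl , refl)) = [ inj₂ ∘ inj₂ , inj₂ ∘ inj₁ ]′ h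

    crossing : ∀ c → Crossing c
    crossing c = crossing-along c (strong M Ku Ku c (not c)) refl (inj₁ ε)

    -- The edge is a bridge w w′ whose w′-side is bipartite: retreat to the w-side.
    module Retreat
      {w w′ : Fin n} (ends : ∀ {p q} → SameEdge u v p q → SameEdge w w′ p q) (Kw : K M w)
      (hit′ : ∀ {x} → K M x → ∀ i → ∃ λ j → (x , i) ⇒ (w , j) ⊎ (x , i) ⇒ (w′ , j))
      (turn : ∀ i → (w , i) ⇒ (w , not i))
      (w⇏w′ : ∀ i j → ¬ (w , i) ⇒ (w′ , j))
      (apart : ∀ i → ¬ (w′ , i) ⇒ (w′ , not i))
      where

      w′⇏w : ∀ i j → ¬ (w′ , i) ⇒ (w , j)
      w′⇏w i j p = w⇏w′ (not j) (not i) (reverse p)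

      w⇒w : ∀ i j → (w , i) ⇒ (w , j)
      w⇒w true  true  = ε
      w⇒w true  false = turn true
      w⇒w false true  = turn false
      w⇒w false false = ε

      K′ : Fin n → Set
      K′ x = K M x × (x , true) ⇒ (w , true)

      A′ : Fin n → Fin n → Bool → Set
      A′ x y i = A M x y i × K′ x × K′ y

      A′-sym : ∀ {x y i} → A′ x y i → A′ y x i
      A′-sym (a , Kx , Ky) = A-sym M a , Ky , Kx

      K′? : ∀ x → Dec (K′ x)
      K′? x = K? M x ×-dec ((x , true) ⇒? (w , true))

      -- Otherwise `(x , not i)` reaches `w′`; the reversal of that path, followed by the given one,
      -- would lead from `w′` to `w`.
      opposite : ∀ {x i j} → K M x → (x , i) ⇒ (w , j) → ∃ λ k → (x , not i) ⇒ (w , k)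
      opposite {i = i} Kx p with hit′ Kx (not i)
      ... | k , inj₁ q = k , q
      ... | k , inj₂ q = contradiction (reverseˡ q ◅◅ p) (w′⇏w (not k) _)

      near : ∀ {x i j} → K M x → (x , i) ⇒ (w , j) → K′ x
      near {i = true}  {j} Kx p = Kx , p ◅◅ w⇒w j true
      near {i = false} Kx p with opposite Kx p
      ... | k , q = Kx , q ◅◅ w⇒w k true

      -- Every state on a path to `w` itself reaches `w`, so by `near` the path never leaves `K′`.
      inside : ∀ {x i t j} → K M x → (x , i) ⇒ t → t ≡ (w , j) → Reach A′ (x , i) t
      inside Kx ε t≡ = ε
      inside Kx (arc n ◅ p) refl =
        arc (proj₁ n , near Kx (arc n ◅ p) , near Ky p) ◅ inside Ky p refl
        where Ky = A⇒K M (A-sym M (proj₁ n))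

      leave : ∀ {x} → K′ x → ∀ i → ∃ λ j → (x , i) ⇒ (w , j)
      leave (_  , p) true  = true , p
      leave (Kx , p) false = opposite Kx p

      K′⇒w : ∀ {x} → K′ x → ∀ i j → Reach A′ (x , i) (w , j)
      K′⇒w K′x i j with leave K′x i
      ... | k , p = inside (proj₁ K′x) (p ◅◅ w⇒w k j) refl

      w⇒K′ : ∀ {x} → K′ x → ∀ i j → Reach A′ (w , j) (x , i)
      w⇒K′ K′x true  true  = Skew.reverse A′-sym (K′⇒w K′x false false)
      w⇒K′ K′x true  false = Skew.reverse A′-sym (K′⇒w K′x false true)
      w⇒K′ K′x false true  = Skew.reverse A′-sym (K′⇒w K′x true false)
      w⇒K′ K′x false false = Skew.reverse A′-sym (K′⇒w K′x true true)

      Far : Fin n → Set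
      Far x = K M x × ¬ K′ x

      far-out : ∀ {x} → Far x → ∀ i → ∃ λ j → (x , i) ⇒ (w′ , j)
      far-out (Kx , ¬K′x) i with hit′ Kx i
      ... | j , inj₁ p = contradiction (near Kx p) ¬K′x
      ... | j , inj₂ p = j , p

      open Bipartition N? far-out apart using (side; side-proper)

      K′w : K′ w
      K′w = Kw , ε

      w′∉K′ : ¬ K′ w′
      w′∉K′ (_ , p) = w′⇏w true true p

      module Extend (φ : Fin n → Bool) where

        -- Outside `K′` the bipartition `side` is copied, oriented so that `w′` differs from `w`.
        -- This extension shows that an edge stubborn in G[K′] would be stubborn in G[K].
        φ⁺ : Fin n → Bool
        φ⁺ p with K′? p
        ... | yes _ = φ p
        ... | no  _ = if side p then not (φ w) else φ w

        side-w′ : side w′ ≡ true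
        side-w′ = dec-true ((w′ , true) ⇒? (w′ , true)) ε

        φ⁺-w : φ⁺ w ≡ φ w
        φ⁺-w with K′? w
        ... | yes _ = refl
        ... | no ¬K = contradiction K′w ¬K

        φ⁺-w′ : φ⁺ w′ ≡ not (φ w)
        φ⁺-w′ with K′? w′
        ... | yes K = contradiction K w′∉K′
        ... | no _ rewrite side-w′ = refl

        φ⁺-bridge : φ⁺ w ≢ φ⁺ w′
        φ⁺-bridge eq = not-¬ {φ w} refl (trans (sym φ⁺-w) (trans eq φ⁺-w′))

        choose-injective : ∀ {k l} b → (if k then not b else b) ≡ (if l then not b else b) → k ≡ l
        choose-injective {true}  {true}  _     _  = refl
        choose-injective {false} {false} _     _  = refl
        choose-injective {true}  {false} true  ()
        choose-injective {true}  {false} false ()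
        choose-injective {false} {true}  true  ()
        choose-injective {false} {true}  false ()

        φ⁺-proper : ∀ {x y} → ProperOff K′ x y φ → ProperOff (K M) x y φ⁺
        φ⁺-proper proper {p} {q} pq Kp Kq e with coloured M pq Kp Kq | sameEdge? u v p q
        ... | _     | yes e′ with ends e′
        ...   | inj₁ (refl , refl) = φ⁺-bridge
        ...   | inj₂ (refl , refl) = φ⁺-bridge ∘ sym
        φ⁺-proper proper {p} {q} pq Kp Kq e | i , a | no e′ with K′? p | K′? q
        -- Apart from the bridge no edge joins `K′` to the rest: its other end would also reach `w`,
        -- hence lie in `K′`.
        ... | yes K′p | yes K′q = proper pq K′p K′q e
        ... | yes K′p | no ¬K′q =
          contradiction (near Kq (arc (N-sym (a , e′)) ◅ proj₂ (leave K′p (not i)))) ¬K′q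
        ... | no ¬K′p | yes K′q =
          contradiction (near Kp (arc (a , e′) ◅ proj₂ (leave K′q (not i)))) ¬K′p
        ... | no ¬K′p | no ¬K′q =
          side-proper (Kp , ¬K′p) (Kq , ¬K′q) (a , e′) ∘ choose-injective (φ w)

      refinement : Refinement M u v
      refinement = M′ , proj₁ , λ ((_ , K′u , K′v) , _) → single K′u K′v
        where
        single : K′ u → K′ v → ⊥
        single K′u K′v with ends (inj₁ (refl , refl))
        ... | inj₁ (refl , refl) = w′∉K′ K′v
        ... | inj₂ (refl , refl) = w′∉K′ K′u

        coloured′ : ∀ {x y} → Adj G x y → K′ x → K′ y → ∃ (A′ x y)
        coloured′ xy K′x K′y with coloured M xy (proj₁ K′x) (proj₁ K′y)
        ... | i , a = i , a , K′x , K′y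

        M′ : Mixed
        M′ = record
          { K        = K′
          ; K?       = K′?
          ; A        = A′
          ; A?       = λ x y i → A? M x y i ×-dec (K′? x ×-dec K′? y)
          ; A-sym    = A′-sym
          ; A⇒Adj    = A⇒Adj M ∘ proj₁
          ; A⇒K      = proj₁ ∘ proj₂
          ; coloured = coloured′
          ; root     = w , K′w
          ; strong   = λ K′x K′y i j → K′⇒w K′x i true ◅◅ w⇒K′ K′y j true
          ; odd      = λ xy K′x K′y φ proper →
              odd M xy (proj₁ K′x) (proj₁ K′y) (Extend.φ⁺ φ) (Extend.φ⁺-proper φ proper)
          }

    -- Without the edge, G[K] is bipartite, so the edge is stubborn in G[K].
    bipartite : (u , true) ⇒ (v , true) → (v , true) ⇒ (u , true) →
                (∀ i → ¬ (u , i) ⇒ (u , not i)) → ⊥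
    bipartite uv vu apart = odd M (A⇒Adj M (free true)) Ku Kv side proper
      where
      out : ∀ {x} → K M x → ∀ i → ∃ λ j → (x , i) ⇒ (u , j)
      out Kx i with hit Kx i
      ... | j     , inj₁ p = j , p
      ... | true  , inj₂ p = true , p ◅◅ vu
      ... | false , inj₂ p = false , p ◅◅ reverse uv

      open Bipartition N? out apart using (side; side-proper)

      proper : ProperOff (K M) u v side
      proper pq Kp Kq e with coloured M pq Kp Kq
      ... | i , a = side-proper Kp Kq (a , e)

    module _ (u⇏v : ¬ (u , true) ⇒ (v , false)) (v⇏u : ¬ (v , false) ⇒ (u , true)) where

      -- A turn at `v` in either direction, with the matching turn at `u`, gives a detour. With no
      -- turn at `v`, the `v`-side is bipartite, and the turns at `u` spread the two missing
      -- connections to all four pairs of states.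
      retreat-u : (u , true) ⇒ (u , false) → (u , false) ⇒ (u , true) → Refinement M u v
      retreat-u p p′ with (v , true) ⇒? (v , false) | (v , false) ⇒? (v , true)
      ... | yes q′ | _     = colour-detour false q′ p
      ... | no _   | yes q = colour-detour true q p′
      ... | no ¬q′ | no ¬q = Retreat.refinement id Ku hit
        (λ { true → p ; false → p′ }) u⇏v⁺ (λ { true → ¬q′ ; false → ¬q })
        where
        u⇏v⁺ : ∀ i j → ¬ (u , i) ⇒ (v , j)
        u⇏v⁺ true  true  r = v⇏u (reverse r ◅◅ p′)
        u⇏v⁺ true  false r = u⇏v r
        u⇏v⁺ false true  r = v⇏u (reverse r)
        u⇏v⁺ false false r = u⇏v (p ◅◅ r)

      retreat-v : (v , false) ⇒ (v , true) → (v , true) ⇒ (v , false) → Refinement M u v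
      retreat-v q q′ with (u , true) ⇒? (u , false) | (u , false) ⇒? (u , true)
      ... | yes p | _      = colour-detour false q′ p
      ... | no _  | yes p′ = colour-detour true q p′
      ... | no ¬p | no ¬p′ = Retreat.refinement Sum.swap Kv
        (λ Kx i → proj₁ (hit Kx i) , Sum.swap (proj₂ (hit Kx i)))
        (λ { true → q′ ; false → q }) v⇏u⁺ (λ { true → ¬p ; false → ¬p′ })
        where
        v⇏u⁺ : ∀ i j → ¬ (v , i) ⇒ (u , j)
        v⇏u⁺ true  true  r = v⇏u (q ◅◅ r)
        v⇏u⁺ true  false r = u⇏v (reverse r)
        v⇏u⁺ false true  r = v⇏u r
        v⇏u⁺ false false r = u⇏v (reverse r ◅◅ q′)

      -- The letters p, q, t stand for a turn at `u`, a turn at `v`, and a passage from `u` to `v`.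
      -- Turns at different ends give a detour, turns at the same end a retreat, a turn and a
      -- passage compose to an excluded direct path, and two passages make G[K] minus the edge
      -- bipartite.
      refine-indirect : Refinement M u v
      refine-indirect with crossing true | crossing false
      ... | inj₁ p        | inj₁ p′        = retreat-u p p′
      ... | inj₁ p        | inj₂ (inj₁ q′) = colour-detour false q′ p
      ... | inj₁ p        | inj₂ (inj₂ t′) = contradiction (p ◅◅ t′) u⇏v
      ... | inj₂ (inj₁ q) | inj₁ p′        = colour-detour true q p′
      ... | inj₂ (inj₁ q) | inj₂ (inj₁ q′) = retreat-v q q′
      ... | inj₂ (inj₁ q) | inj₂ (inj₂ t′) = contradiction (q ◅◅ reverse t′) v⇏u
      ... | inj₂ (inj₂ t) | inj₁ p′        = contradiction (reverse t ◅◅ p′) v⇏u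
      ... | inj₂ (inj₂ t) | inj₂ (inj₁ q′) = contradiction (t ◅◅ q′) u⇏v
      ... | inj₂ (inj₂ t) | inj₂ (inj₂ t′) = ⊥-elim (bipartite t (reverse t′) λ
        { true p → u⇏v (p ◅◅ t′) ; false p′ → v⇏u (reverse t ◅◅ p′) })

    -- The paths tested are, up to reversal, the ones that `colour-direct` needs for the colours
    -- `false` and `true`.
    refine-free : Refinement M u v
    refine-free with (u , true) ⇒? (v , false) | (v , false) ⇒? (u , true)
    ... | yes p | _     = colour-direct false (reverse p)
    ... | no _  | yes p = colour-direct true p
    ... | no ¬p | no ¬q = refine-indirect ¬p ¬q

  -- Settling all edges.

  refine : ∀ M u v → Refinement M u v
  refine M u v with A? M u v true | A? M u v false
  ... | yes t | yes f = Refine.refine-free M u v λ { true → t ; false → f }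
  ... | no ¬t | _     = M , id , ¬t ∘ proj₁
  ... | yes _ | no ¬f = M , id , ¬f ∘ proj₂

  -- Arrows are only ever removed, so an edge once settled stays settled.
  refine-all : ∀ L M → Σ Mixed λ M′ → M′ ⊑ M × (∀ {x y} → (x , y) ∈ L → Single M′ x y)
  refine-all [] M = M , id , λ ()
  refine-all ((u , v) ∷ L) M with refine M u v
  ... | M₁ , M₁⊑M , uv with refine-all L M₁
  ...   | M₂ , M₂⊑M₁ , all = M₂ , (λ a → M₁⊑M (M₂⊑M₁ a)) , λ
    { (here refl) (t , f) → uv (M₂⊑M₁ t , M₂⊑M₁ f)
    ; (there xy∈L) → all xy∈L }

  refine-total : Mixed → Σ Mixed λ M → ∀ x y → Single M x y
  refine-total M with refine-all (cartesianProduct (allFin n) (allFin n)) M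
  ... | M′ , _ , all = M′ , λ x y → all (∈-cartesianProduct⁺ (∈-allFin x) (∈-allFin y))

  -- Attaching the remaining vertices.

  Coloured : (Fin n → Set) → (Fin n → Fin n → Bool) → Fin n → Fin n → Bool → Set
  Coloured K col x y i = Adj G x y × K x × K y × col x y ≡ i

  -- Reaching the state (y , not (pref y)) means that the last edge had colour pref y.
  record Linked : Set₁ where
    field
      D       : Fin n → Set
      D?      : ∀ x → Dec (D x)
      col     : Fin n → Fin n → Bool
      col-sym : ∀ x y → col x y ≡ col y x
      pref    : Fin n → Bool
      link    : ∀ {x y} → D x → D y → Reach (Coloured D col) (x , pref x) (y , not (pref y))

  _⊆_ : Linked → Linked → Set
  L ⊆ L′ = ∀ {x} → Linked.D L x → Linked.D L′ x

  module Attach (L : Linked) {p w : Fin n} (Dp : Linked.D L p) (w∉D : ¬ Linked.D L w) (pw : Adj G p w) where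
    open Linked L

    D⁺ : Fin n → Set
    D⁺ x = D x ⊎ x ≡ w

    d : Bool
    d = not (pref p)

    -- All edges at `w` are recoloured; as `w` was outside `D`, no path found so far uses them.
    col⁺ : Fin n → Fin n → Bool
    col⁺ x y = if does (x Fin.≟ w) then d else if does (y Fin.≟ w) then d else col x y

    pref⁺ : Fin n → Bool
    pref⁺ x = if does (x Fin.≟ w) then d else pref x

    col⁺-sym : ∀ x y → col⁺ x y ≡ col⁺ y x
    col⁺-sym x y with does (x Fin.≟ w) | does (y Fin.≟ w)
    ... | true  | true  = refl
    ... | true  | false = refl
    ... | false | true  = refl
    ... | false | false = col-sym x y

    ≢w : ∀ {x} → D x → does (x Fin.≟ w) ≡ false
    ≢w {x} Dx = dec-false (x Fin.≟ w) λ { refl → w∉D Dx }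

    ≡w : does (w Fin.≟ w) ≡ true
    ≡w = dec-true (w Fin.≟ w) refl

    old : ∀ {s t} → Reach (Coloured D col) s t → Reach (Coloured D⁺ col⁺) s t
    old = reach-mono λ { (xy , Dx , Dy , eq) → xy , inj₁ Dx , inj₁ Dy , trans (same Dx Dy) eq }
      where
      same : ∀ {x y} → D x → D y → col⁺ x y ≡ col x y
      same Dx Dy rewrite ≢w Dx | ≢w Dy = refl

    down : Reach (Coloured D⁺ col⁺) (p , d) (w , not d)
    down = arc (pw , inj₁ Dp , inj₂ refl , eq) ◅ ε
      where
      eq : col⁺ p w ≡ d
      eq rewrite ≢w Dp | ≡w = refl

    up : Reach (Coloured D⁺ col⁺) (w , d) (p , pref p)
    up = subst (λ i → Reach (Coloured D⁺ col⁺) (w , d) (p , i)) (not-involutive (pref p))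
      (arc (Adj-sym pw , inj₂ refl , inj₁ Dp , eq) ◅ ε)
      where
      eq : col⁺ w p ≡ d
      eq rewrite ≡w = refl

    link⁺ : ∀ {x y} → D⁺ x → D⁺ y → Reach (Coloured D⁺ col⁺) (x , pref⁺ x) (y , not (pref⁺ y))
    link⁺ (inj₁ Dx)   (inj₁ Dy)   rewrite ≢w Dx | ≢w Dy = old (link Dx Dy)
    link⁺ (inj₁ Dx)   (inj₂ refl) rewrite ≢w Dx | ≡w    = old (link Dx Dp) ◅◅ down
    link⁺ (inj₂ refl) (inj₁ Dy)   rewrite ≢w Dy | ≡w    = up ◅◅ old (link Dp Dy)
    -- The link from `p` to itself separates the two uses of the edge pw, which would otherwise
    -- repeat colour `d`.
    link⁺ (inj₂ refl) (inj₂ refl) rewrite ≡w            = up ◅◅ (old (link Dp Dp) ◅◅ down)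

    attached : Linked
    attached = record
      { D = D⁺ ; D? = λ x → D? x ⊎-dec (x Fin.≟ w)
      ; col = col⁺ ; col-sym = col⁺-sym ; pref = pref⁺ ; link = link⁺ }

  attach : ∀ L {p w} → Linked.D L p → Adj G p w → Σ Linked λ L′ → L ⊆ L′ × Linked.D L′ w
  attach L {w = w} Dp pw with Linked.D? L w
  ... | yes Dw = L , id , Dw
  ... | no ¬Dw = Attach.attached L Dp ¬Dw pw , inj₁ , inj₂ refl

  attach-walk : ∀ L {p y} → Linked.D L p → Walk G p y → Σ Linked λ L′ → L ⊆ L′ × Linked.D L′ y
  attach-walk L Dp [ _ ] = L , id , Dp
  attach-walk L Dp (_ ∷⟨ pw ⟩ W) with attach L Dp pw
  ... | L₁ , L⊆L₁ , Dw with attach-walk L₁ Dw W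
  ...   | L₂ , L₁⊆L₂ , Dy = L₂ , (λ Dx → L₁⊆L₂ (L⊆L₁ Dx)) , Dy

  attach-all : Connected G → ∀ ys L {r} → Linked.D L r →
               Σ Linked λ L′ → L ⊆ L′ × (∀ {y} → y ∈ ys → Linked.D L′ y)
  attach-all conn [] L Dr = L , id , λ ()
  attach-all conn (y ∷ ys) L {r} Dr with attach-walk L Dr (conn r y)
  ... | L₁ , L⊆L₁ , Dy with attach-all conn ys L₁ (L⊆L₁ Dr)
  ...   | L₂ , L₁⊆L₂ , all = L₂ , (λ Dx → L₁⊆L₂ (L⊆L₁ Dx)) , λ
    { (here refl) → L₁⊆L₂ Dy ; (there y∈ys) → all y∈ys }

  -- Strong connectivity joins all states over `K`, so a constant preference suffices.
  single⇒linked : (M : Mixed) → (∀ x y → Single M x y) → Linked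
  single⇒linked M single = record
    { D = K M ; D? = K? M ; col = col ; col-sym = col-sym ; pref = λ _ → true
    ; link = λ Kx Ky → reach-mono
        (λ a → A⇒Adj M a , A⇒K M a , A⇒K M (A-sym M a) , col-A a) (strong M Kx Ky true false) }
    where
    col : Fin n → Fin n → Bool
    col x y = does (A? M x y true)

    col-A : ∀ {x y i} → A M x y i → col x y ≡ i
    col-A {x} {y} {true}  a = dec-true (A? M x y true) a
    col-A {x} {y} {false} a = dec-false (A? M x y true) λ t → single x y (t , a)

    col-sym : ∀ x y → col x y ≡ col y x
    col-sym x y with A? M y x true
    ... | yes a = dec-true (A? M x y true) (A-sym M a)
    ... | no ¬a = dec-false (A? M x y true) (¬a ∘ A-sym M)

  -- Properly coloured walks from paths of states.

  module _ (L : Linked) where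
    open Linked L

    tint : Bool → Fin 2
    tint true  = zero
    tint false = suc zero

    tint-not : ∀ i → tint i ≢ tint (not i)
    tint-not true  ()
    tint-not false ()

    colouring : Colouring G
    colouring = record { col = λ x y → tint (col x y) ; col-sym = λ x y → cong tint (col-sym x y) }

    -- Records the first colour for comparison with an edge put in front. The empty walk imposes no
    -- condition.
    Starts : Bool → ∀ {x y} → Walk G x y → Set
    Starts i [ _ ] = i ≡ i
    Starts i (_∷⟨_⟩_ u {w} _ _) = col u w ≡ i

    reach⇒walk : ∀ {x i t} → Reach (Coloured D col) (x , i) t →
                 Σ (Walk G x (proj₁ t)) λ W → ProperlyColoured G colouring W × Starts i W
    reach⇒walk ε = [ _ ] , tt , refl
    reach⇒walk {x} {i} (arc (xy , _ , _ , eq) ◅ p) with reach⇒walk p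
    ... | W@([ _ ]) , _ , _ = (x ∷⟨ xy ⟩ W) , tt , eq
    ... | W@(_ ∷⟨ _ ⟩ _) , proper , starts = (x ∷⟨ xy ⟩ W) , (differ , proper) , eq
      where
      differ : _
      differ e rewrite eq | starts = tint-not i e

  mixed⇒connected : Connected G → Mixed → Σ (Colouring G) (ProperlyConnected G)
  mixed⇒connected conn M with refine-total M
  ... | M₁ , single with attach-all conn (allFin n) (single⇒linked M₁ single) (proj₂ (root M₁))
  ...   | L , _ , all = colouring L , λ u v →
    let W , proper , _ = reach⇒walk L (Linked.link L (all (∈-allFin u)) (all (∈-allFin v))) in W , proper

  -- The uncoloured graph without stubborn edges.

  usesEdge? : ∀ x y {u v} (W : Walk G u v) → Dec (UsesEdge G x y W)
  usesEdge? x y [ _ ] = no λ ()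
  usesEdge? x y (_∷⟨_⟩_ u {w} _ W) = sameEdge? x y u w ⊎-dec usesEdge? x y W

  alternate : ℕ → Bool → Bool
  alternate zero    b = b
  alternate (suc k) b = not (alternate k b)

  alternate-double : ∀ k b → alternate (k + k) b ≡ b
  alternate-double zero    b = refl
  alternate-double (suc k) b rewrite +-suc k k | not-involutive (alternate (k + k) b) = alternate-double k b

  Everywhere : Fin n → Set
  Everywhere x = ⊤

  alternates : ∀ {x y φ} → ProperOff Everywhere x y φ → ∀ {u v} (W : Walk G u v) →
               ¬ UsesEdge G x y W → φ u ≡ alternate (len G W) (φ v)
  alternates proper [ _ ] _ = refl
  alternates proper (_ ∷⟨ uw ⟩ W) avoid =
    trans (¬-not (proper uw tt tt (avoid ∘ inj₁))) (cong not (alternates proper W (avoid ∘ inj₂)))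

  module _ (conn : Connected G) (free : ∀ x y → ¬ Stubborn G x y) where

    -- Along a closed walk avoiding xy, `φ` flips at every step, so an odd length would make `φ u`
    -- differ from itself. Hence xy would be stubborn.
    not-bipartite : ∀ {x y} → Adj G x y → ∀ φ → ¬ ProperOff Everywhere x y φ
    not-bipartite {x} {y} xy φ proper = free x y (xy , uses)
      where
      uses : ∀ u (W : Walk G u u) → Odd (len G W) → UsesEdge G x y W
      uses u W (k , len≡) with usesEdge? x y W
      ... | yes e = e
      ... | no ¬e with len G W | alternates proper W ¬e | len≡
      ...   | _ | eq | refl rewrite alternate-double k (φ u) = contradiction eq (not-¬ refl)

    B : Fin n → Fin n → Bool → Set
    B x y _ = Adj G x y

    B? : ∀ x y i → Dec (B x y i)
    B? x y _ = T? (adj x y)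

    walk⇒reach : ∀ {x y} → Walk G x y → ∀ i → ∃ λ j → Reach B (x , i) (y , j)
    walk⇒reach [ _ ] i = i , ε
    walk⇒reach (_ ∷⟨ xw ⟩ W) i with walk⇒reach W (not i)
    ... | j , p = j , arc xw ◅ p

    -- While no edge is coloured, exchanging the two colours is an automorphism of the state
    -- digraph.
    flip : ∀ {x y i j} → Reach B (x , i) (y , j) → Reach B (x , not i) (y , not j)
    flip = gmap (λ (x , i) → x , not i) λ { (arc a) → arc a }

    module _ {r s : Fin n} (rs : Adj G r s) where

      -- Otherwise, by `flip`, neither state of `r` reaches the other, and all of G is two-coloured.
      r⇒r : Reach B (r , true) (r , false)
      r⇒r with reach? B? (r , true) (r , false)
      ... | yes p = p
      ... | no ¬p = ⊥-elim (not-bipartite rs side λ {p} {q} pq _ _ _ → side-proper {i = true} tt tt pq)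
        where
        out : ∀ {x} → Everywhere x → ∀ i → ∃ λ j → Reach B (x , i) (r , j)
        out {x} _ = walk⇒reach (conn x r)

        apart : ∀ i → ¬ Reach B (r , i) (r , not i)
        apart true  = ¬p
        apart false = ¬p ∘ flip

        open Skew.Bipartition {A = B} Adj-sym B? out apart using (side; side-proper)

      -- A walk to `y` may arrive in the wrong state; `flip` and the turn at `r` correct it at
      -- either end.
      r⇒all : ∀ y i j → Reach B (r , i) (y , j)
      r⇒all y i j with walk⇒reach (conn r y) true
      ... | k , p with j Bool.≟ k | i
      ...   | yes refl | true  = p
      ...   | yes refl | false = flip r⇒r ◅◅ p
      ...   | no  j≢k  | true  rewrite ¬-not j≢k = r⇒r ◅◅ flip p
      ...   | no  j≢k  | false rewrite ¬-not j≢k = flip p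

      uncoloured : Mixed
      uncoloured = record
        { K = Everywhere ; K? = λ _ → yes tt ; A = B ; A? = B? ; A-sym = Adj-sym
        ; A⇒Adj = id ; A⇒K = λ _ → tt ; coloured = λ xy _ _ → true , xy ; root = r , tt
        ; strong = λ {x} {y} _ _ i j →
            let k , p = walk⇒reach (conn x r) i in p ◅◅ r⇒all y k j
        ; odd = λ xy _ _ → not-bipartite xy }

    connectable : ∀ {r s} → r ≢ s → Walk G r s → Σ (Colouring G) (ProperlyConnected G)
    connectable r≢s [ _ ]         = contradiction refl r≢s
    connectable r≢s (_ ∷⟨ rw ⟩ _) = mixed⇒connected conn (uncoloured rw)

theorem5 : (n : ℕ) (G : Graph n) → Connected G →
    (∀ (x y : Fin n) → ¬ Stubborn G x y) →
    Σ (Colouring G) (λ c → ProperlyConnected G c)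
theorem5 zero          G conn free = record { col = λ () ; col-sym = λ () } , λ ()
theorem5 (suc zero)    G conn free =
  record { col = λ _ _ → zero ; col-sym = λ _ _ → refl } , λ { zero zero → [ zero ] , tt }
-- Two distinct vertices are needed so that the walk between them supplies a first edge.
theorem5 (suc (suc n)) G conn free = connectable G conn free {zero} {suc zero} (λ ()) (conn zero (suc zero))
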